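{- The $\lambda^{\textsc{prk}}$-calculus is confluent: for all typable terms $t_0,t_1,t_2$ of $\lambda^{\textsc{prk}}$ such that $t_0\to^*t_1$ and $t_0\to^*t_2$, there is a term $t_3$ such that $t_1\to^*t_3$ and $t_2\to^*t_3$.
   Context: **Types.** Fix a denumerable set of propositional variables $\alpha$. Pure propositions: $A,B ::= \alpha \mid A\land B\mid A\lor B\mid \neg A$. Types (moded propositions): $P,Q ::= A^+\mid A^-\mid A^\oplus\mid A^\ominus$; $A^+,A^-$ are strong, $A^\oplus,A^\ominus$ classical. Opposite: $(A^+)^\sim=A^-$, $(A^-)^\sim=A^+$, $(A^\oplus)^\sim=A^\ominus$, $(A^\ominus)^\sim=A^\oplus$. **Terms of $\lambda^{\textsc{prk}}$.** ($i\in\{1,2\}$, $\pm\in\{+,-\}$; $x,y$ from a denumerable set of variables) $$t,s,u ::= x \mid t\blacktriangleright\!\blacktriangleleft_P s\mid \langle t,s\rangle^\pm\mid \pi_i^\pm(t)\mid \mathsf{in}_i^\pm(t)\mid \delta^\pm t[_{x:P}.s][_{y:Q}.u]\mid \nu^\pm t\mid \mu^\pm t\mid \mathsf{IC}^\pm_{(x:P)}.t\mid t\bullet^\pm s.$$ In $\delta^\pm t[_{x:P}.s][_{y:Q}.u]$, $x$ is bound in $s$ and $y$ in $u$; in $\mathsf{IC}^\pm_{(x:P)}.t$, $x$ is bound in $t$. Terms are taken modulo $\alpha$-renaming; $t[x:=s]$ is capture-avoiding substitution. Type annotations may be omitted. **Typing.** Typing contexts $\Gamma$ are finite lists $x_1:P_1,\dots,x_n:P_n$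 with distinct variables, up to reordering. A term $t$ is typable if $\Gamma\vdash t:P$ for some $\Gamma,P$. Rules: - (Ax) $\Gamma,x:P\vdash x:P$. (Abs) $\Gamma\vdash t:P$, $\Gamma\vdash s:P^\sim$, $P$ strong $\Rightarrow$ $\Gamma\vdash t\blacktriangleright\!\blacktriangleleft_Q s:Q$. - $\Gamma\vdash t:A^\oplus$, $\Gamma\vdash s:B^\oplus$ $\Rightarrow$ $\Gamma\vdash\langle t,s\rangle^+:(A\land B)^+$. $\Gamma\vdash t:A^\ominus$, $\Gamma\vdash s:B^\ominus$ $\Rightarrow$ $\Gamma\vdash\langle t,s\rangle^-:(A\lor B)^-$. - $\Gamma\vdash t:(A_1\land A_2)^+$ $\Rightarrow$ $\Gamma\vdash\pi^+_i(t):A_i^\oplus$. $\Gamma\vdash t:(A_1\lor A_2)^-$ $\Rightarrow$ $\Gamma\vdash\pi^-_i(t):A_i^\ominus$. - $\Gamma\vdash t:A_i^\oplus$ $\Rightarrow$ $\Gamma\vdash\mathsf{in}^+_i(t):(A_1\lor A_2)^+$. $\Gamma\vdash t:A_i^\ominus$ $\Rightarrow$ $\Gamma\vdash\mathsf{in}^-_i(t):(A_1\land A_2)^-$. - $\Gamma\vdash t:(A\lor B)^+$, $\Gamma,x:A^\oplus\vdash s:P$, $\Gamma,y:B^\oplus\vdash u:P$ $\Rightarrow$ $\Gamma\vdash\delta^+t[_{x:A^\oplus}.s][_{y:B^\oplus}.u]:P$. $\Gamma\vdash t:(A\land B)^-$, $\Gamma,x:A^\ominus\vdash s:P$, $\Gamma,y:B^\ominus\vdash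 u:P$ $\Rightarrow$ $\Gamma\vdash\delta^-t[_{x:A^\ominus}.s][_{y:B^\ominus}.u]:P$. - $\Gamma\vdash t:A^\ominus$ $\Rightarrow$ $\Gamma\vdash\nu^+t:(\neg A)^+$. $\Gamma\vdash t:A^\oplus$ $\Rightarrow$ $\Gamma\vdash\nu^-t:(\neg A)^-$. $\Gamma\vdash t:(\neg A)^+$ $\Rightarrow$ $\Gamma\vdash\mu^+t:A^\ominus$. $\Gamma\vdash t:(\neg A)^-$ $\Rightarrow$ $\Gamma\vdash\mu^-t:A^\oplus$. - $\Gamma,x:A^\ominus\vdash t:A^+$ $\Rightarrow$ $\Gamma\vdash\mathsf{IC}^+_{(x:A^\ominus)}.t:A^\oplus$. $\Gamma,x:A^\oplus\vdash t:A^-$ $\Rightarrow$ $\Gamma\vdash\mathsf{IC}^-_{(x:A^\oplus)}.t:A^\ominus$. - $\Gamma\vdash t:A^\oplus$, $\Gamma\vdash s:A^\ominus$ $\Rightarrow$ $\Gamma\vdash t\bullet^+s:A^+$. $\Gamma\vdash t:A^\ominus$, $\Gamma\vdash s:A^\oplus$ $\Rightarrow$ $\Gamma\vdash t\bullet^-s:A^-$. **Generalized absurdity.** For $t:P$ and $s:P^\sim$, $t\bowtie_Q s$ denotes: $t\blacktriangleright\!\blacktriangleleft_Q s$ if $P$ is strong; $(t\bullet^+s)\blacktriangleright\!\blacktriangleleft_Q(s\bullet^-t)$ if $P=A^\oplus$; $(t\bullet^-s)\blacktriangleright\!\blacktriangleleft_Q(s\bullet^+t)$ if $P=A^\ominus$.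 **Reduction.** $\to$ is defined on typable terms as the closure under arbitrary contexts of the following rules (in each rule all $\pm$ denote the same sign, $\mp$ the opposite sign, and $i\in\{1,2\}$); $\to^*$ is its reflexive-transitive closure: - $\pi_i^\pm(\langle t_1,t_2\rangle^\pm)\to t_i$; - $\delta^\pm(\mathsf{in}_i^\pm(t))[_x.s_1][_x.s_2]\to s_i[x:=t]$; - $\mu^\pm(\nu^\pm t)\to t$; - $(\mathsf{IC}^\pm_x.t)\bullet^\pm s\to t[x:=s]$; - $\langle t_1,t_2\rangle^\pm\blacktriangleright\!\blacktriangleleft_Q\mathsf{in}_i^\mp(s)\to t_i\bowtie_Q s$; - $\mathsf{in}_i^\pm(t)\blacktriangleright\!\blacktriangleleft_Q\langle s_1,s_2\rangle^\mp\to t\bowtie_Q s_i$; - $(\nu^\pm t)\blacktriangleright\!\blacktriangleleft_Q(\nu^\mp s)\to t\bowtie_Q s$. -}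

module Defs where

open import Data.Nat using (ℕ; suc)
open import Data.Fin using (Fin; zero; suc)
open import Data.Fin.Substitution using (Lift; Sub; TermSubst)
open import Data.Product using (_×_; ∃₂)
open import Data.Sign using (Sign; +; -; opposite)
open import Data.Vec using (Vec; _∷_; lookup)
open import Relation.Binary.Construct.Closure.ReflexiveTransitive using (Star)

infixr 7 _∧_
infixr 6 _∨_
infix  8 `¬_
infix  5 _⁺ _⁻ _⊕ _⊖
infix  5 _~

data Form : Set where
  atom    : ℕ → Form
  _∧_ _∨_ : Form → Form → Form
  `¬_     : Form → Form

data Type : Set where
  _⁺ _⁻ _⊕ _⊖ : Form → Type

_~ : Type → Type
(A ⁺) ~ = A ⁻
(A ⁻) ~ = A ⁺
(A ⊕) ~ = A ⊖
(A ⊖) ~ = A ⊕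

data Strong : Type → Set where
  pos : ∀ {A} → Strong (A ⁺)
  neg : ∀ {A} → Strong (A ⁻)

-- Indices i ∈ {1,2} are elements of Fin 2, so that the schematic xᵢ is
-- choose i x₁ x₂.
choose : ∀ {X : Set} → Fin 2 → X → X → X
choose zero       x₁ x₂ = x₁
choose (suc zero) x₁ x₂ = x₂

-- Well-scoped de Bruijn terms: Term n is the set of α-equivalence classes of
-- terms with free variables among n given ones. The annotation Q of
-- t ▶◀[ Q ] s is the type of the whole term; the other annotations are the
-- types of bound variables.
infix 6 _▶◀[_]_ _●[_]_

data Term (n : ℕ) : Set where
  var     : Fin n → Term n
  _▶◀[_]_ : Term n → Type → Term n → Term n
  pair    : Sign → Term n → Term n → Term n
  π       : Sign → Fin 2 → Term n → Term n
  inj     : Sign → Fin 2 → Term n → Term n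
  δ       : Sign → Term n → Type → Term (suc n) → Type → Term (suc n) → Term n
  ν μ     : Sign → Term n → Term n
  IC      : Sign → Type → Term (suc n) → Term n
  _●[_]_  : Term n → Sign → Term n → Term n

module TermApp {T : ℕ → Set} (l : Lift T Term) where
  open Lift l hiding (var)

  infixl 8 _/_

  _/_ : ∀ {m n} → Term m → Sub T m n → Term n
  var x         / ρ = lift (lookup ρ x)
  (t ▶◀[ Q ] s) / ρ = (t / ρ) ▶◀[ Q ] (s / ρ)
  pair σ t s    / ρ = pair σ (t / ρ) (s / ρ)
  π σ i t       / ρ = π σ i (t / ρ)
  inj σ i t     / ρ = inj σ i (t / ρ)
  δ σ t P s Q u / ρ = δ σ (t / ρ) P (s / ρ ↑) Q (u / ρ ↑)
  ν σ t         / ρ = ν σ (t / ρ)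
  μ σ t         / ρ = μ σ (t / ρ)
  IC σ P t      / ρ = IC σ P (t / ρ ↑)
  (t ●[ σ ] s)  / ρ = (t / ρ) ●[ σ ] (s / ρ)

termSubst : TermSubst Term
termSubst = record { var = var; app = TermApp._/_ }

open TermSubst termSubst public using (_/_; sub)

-- Entry x of a context is the type of the variable x. Since variables are
-- positions, they are distinct, and the order of declarations is immaterial.
Ctx : ℕ → Set
Ctx = Vec Type

infix 4 _⊢_∶_

data _⊢_∶_ {n : ℕ} (Γ : Ctx n) : Term n → Type → Set where
  ax    : ∀ x → Γ ⊢ var x ∶ lookup Γ x
  abs   : ∀ {t s P Q} → Strong P → Γ ⊢ t ∶ P → Γ ⊢ s ∶ P ~ →
          Γ ⊢ t ▶◀[ Q ] s ∶ Q
  pair⁺ : ∀ {t s A B} → Γ ⊢ t ∶ A ⊕ → Γ ⊢ s ∶ B ⊕ →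
          Γ ⊢ pair + t s ∶ (A ∧ B) ⁺
  pair⁻ : ∀ {t s A B} → Γ ⊢ t ∶ A ⊖ → Γ ⊢ s ∶ B ⊖ →
          Γ ⊢ pair - t s ∶ (A ∨ B) ⁻
  π⁺    : ∀ {t A₁ A₂} i → Γ ⊢ t ∶ (A₁ ∧ A₂) ⁺ →
          Γ ⊢ π + i t ∶ (choose i A₁ A₂) ⊕
  π⁻    : ∀ {t A₁ A₂} i → Γ ⊢ t ∶ (A₁ ∨ A₂) ⁻ →
          Γ ⊢ π - i t ∶ (choose i A₁ A₂) ⊖
  inj⁺  : ∀ {t A₁ A₂} i → Γ ⊢ t ∶ (choose i A₁ A₂) ⊕ →
          Γ ⊢ inj + i t ∶ (A₁ ∨ A₂) ⁺
  inj⁻  : ∀ {t A₁ A₂} i → Γ ⊢ t ∶ (choose i A₁ A₂) ⊖ →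
          Γ ⊢ inj - i t ∶ (A₁ ∧ A₂) ⁻
  δ⁺    : ∀ {t s u A B P} → Γ ⊢ t ∶ (A ∨ B) ⁺ →
          (A ⊕) ∷ Γ ⊢ s ∶ P → (B ⊕) ∷ Γ ⊢ u ∶ P →
          Γ ⊢ δ + t (A ⊕) s (B ⊕) u ∶ P
  δ⁻    : ∀ {t s u A B P} → Γ ⊢ t ∶ (A ∧ B) ⁻ →
          (A ⊖) ∷ Γ ⊢ s ∶ P → (B ⊖) ∷ Γ ⊢ u ∶ P →
          Γ ⊢ δ - t (A ⊖) s (B ⊖) u ∶ P
  ν⁺    : ∀ {t A} → Γ ⊢ t ∶ A ⊖ → Γ ⊢ ν + t ∶ (`¬ A) ⁺
  ν⁻    : ∀ {t A} → Γ ⊢ t ∶ A ⊕ → Γ ⊢ ν - t ∶ (`¬ A) ⁻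
  μ⁺    : ∀ {t A} → Γ ⊢ t ∶ (`¬ A) ⁺ → Γ ⊢ μ + t ∶ A ⊖
  μ⁻    : ∀ {t A} → Γ ⊢ t ∶ (`¬ A) ⁻ → Γ ⊢ μ - t ∶ A ⊕
  IC⁺   : ∀ {t A} → (A ⊖) ∷ Γ ⊢ t ∶ A ⁺ → Γ ⊢ IC + (A ⊖) t ∶ A ⊕
  IC⁻   : ∀ {t A} → (A ⊕) ∷ Γ ⊢ t ∶ A ⁻ → Γ ⊢ IC - (A ⊕) t ∶ A ⊖
  app⁺  : ∀ {t s A} → Γ ⊢ t ∶ A ⊕ → Γ ⊢ s ∶ A ⊖ → Γ ⊢ t ●[ + ] s ∶ A ⁺
  app⁻  : ∀ {t s A} → Γ ⊢ t ∶ A ⊖ → Γ ⊢ s ∶ A ⊕ → Γ ⊢ t ●[ - ] s ∶ A ⁻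

Typable : ∀ {n} → Term n → Set
Typable t = ∃₂ λ Γ P → Γ ⊢ t ∶ P

-- t ⋈[ P , Q ] s is the generalized absurdity t ⋈_Q s for t : P and s : P ~.
infix 6 _⋈[_,_]_

_⋈[_,_]_ : ∀ {n} → Term n → Type → Type → Term n → Term n
t ⋈[ A ⁺ , Q ] s = t ▶◀[ Q ] s
t ⋈[ A ⁻ , Q ] s = t ▶◀[ Q ] s
t ⋈[ A ⊕ , Q ] s = (t ●[ + ] s) ▶◀[ Q ] (s ●[ - ] t)
t ⋈[ A ⊖ , Q ] s = (t ●[ - ] s) ▶◀[ Q ] (s ●[ + ] t)

-- The context Γ serves only to determine the type of the operands of ⋈, which
-- raw terms do not record; hence going under a binder extends Γ with the
-- annotation.
infix 4 _⊢_↝_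

data _⊢_↝_ {n : ℕ} (Γ : Ctx n) : Term n → Term n → Set where
  π-pair   : ∀ {σ i t₁ t₂} →
             Γ ⊢ π σ i (pair σ t₁ t₂) ↝ choose i t₁ t₂
  δ-inj    : ∀ {σ i t P₁ s₁ P₂ s₂} →
             Γ ⊢ δ σ (inj σ i t) P₁ s₁ P₂ s₂ ↝ choose i s₁ s₂ / sub t
  μ-ν      : ∀ {σ t} → Γ ⊢ μ σ (ν σ t) ↝ t
  IC-●     : ∀ {σ P t s} → Γ ⊢ IC σ P t ●[ σ ] s ↝ t / sub s
  pair-inj : ∀ {σ i t₁ t₂ s P Q} →
             Γ ⊢ choose i t₁ t₂ ∶ P → Γ ⊢ s ∶ P ~ →
             Γ ⊢ pair σ t₁ t₂ ▶◀[ Q ] inj (opposite σ) i s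
               ↝ choose i t₁ t₂ ⋈[ P , Q ] s
  inj-pair : ∀ {σ i t s₁ s₂ P Q} →
             Γ ⊢ t ∶ P → Γ ⊢ choose i s₁ s₂ ∶ P ~ →
             Γ ⊢ inj σ i t ▶◀[ Q ] pair (opposite σ) s₁ s₂
               ↝ t ⋈[ P , Q ] choose i s₁ s₂
  ν-ν      : ∀ {σ t s P Q} →
             Γ ⊢ t ∶ P → Γ ⊢ s ∶ P ~ →
             Γ ⊢ ν σ t ▶◀[ Q ] ν (opposite σ) s ↝ t ⋈[ P , Q ] s

  ξ-▶◀ˡ    : ∀ {t t′ Q s} → Γ ⊢ t ↝ t′ → Γ ⊢ t ▶◀[ Q ] s ↝ t′ ▶◀[ Q ] s
  ξ-▶◀ʳ    : ∀ {t Q s s′} → Γ ⊢ s ↝ s′ → Γ ⊢ t ▶◀[ Q ] s ↝ t ▶◀[ Q ] s′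
  ξ-pairˡ  : ∀ {σ t t′ s} → Γ ⊢ t ↝ t′ → Γ ⊢ pair σ t s ↝ pair σ t′ s
  ξ-pairʳ  : ∀ {σ t s s′} → Γ ⊢ s ↝ s′ → Γ ⊢ pair σ t s ↝ pair σ t s′
  ξ-π      : ∀ {σ i t t′} → Γ ⊢ t ↝ t′ → Γ ⊢ π σ i t ↝ π σ i t′
  ξ-inj    : ∀ {σ i t t′} → Γ ⊢ t ↝ t′ → Γ ⊢ inj σ i t ↝ inj σ i t′
  ξ-δ      : ∀ {σ t t′ P s Q u} → Γ ⊢ t ↝ t′ →
             Γ ⊢ δ σ t P s Q u ↝ δ σ t′ P s Q u
  ξ-δˡ     : ∀ {σ t P s s′ Q u} → P ∷ Γ ⊢ s ↝ s′ →
             Γ ⊢ δ σ t P s Q u ↝ δ σ t P s′ Q u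
  ξ-δʳ     : ∀ {σ t P s Q u u′} → Q ∷ Γ ⊢ u ↝ u′ →
             Γ ⊢ δ σ t P s Q u ↝ δ σ t P s Q u′
  ξ-ν      : ∀ {σ t t′} → Γ ⊢ t ↝ t′ → Γ ⊢ ν σ t ↝ ν σ t′
  ξ-μ      : ∀ {σ t t′} → Γ ⊢ t ↝ t′ → Γ ⊢ μ σ t ↝ μ σ t′
  ξ-IC     : ∀ {σ P t t′} → P ∷ Γ ⊢ t ↝ t′ → Γ ⊢ IC σ P t ↝ IC σ P t′
  ξ-●ˡ     : ∀ {σ t t′ s} → Γ ⊢ t ↝ t′ → Γ ⊢ t ●[ σ ] s ↝ t′ ●[ σ ] s
  ξ-●ʳ     : ∀ {σ t s s′} → Γ ⊢ s ↝ s′ → Γ ⊢ t ●[ σ ] s ↝ t ●[ σ ] s′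

-- Only typable terms reduce.
infix 4 _⟶_ _⟶*_

_⟶_ : ∀ {n} → Term n → Term n → Set
t ⟶ s = ∃₂ λ Γ P → (Γ ⊢ t ∶ P) × (Γ ⊢ t ↝ s)

_⟶*_ : ∀ {n} → Term n → Term n → Set
_⟶*_ = Star _⟶_

module Submission where

-- The terms of λᴾᴿᴷ form an orthogonal higher-order rewriting system: no two
-- redexes overlap, and on typable terms the contractum of an absurdity redex
-- depends only on its sign, not on the types of the operands. Hence parallel
-- reduction can be defined on raw terms, where it has the diamond property
-- (Tait and Martin-Löf). Since it also preserves typing, a joining of t₁ and t₂
-- by raw reductions can be replayed as typed ones from the given typings of t₁
-- and t₂; the contexts used along the two original reductions play no role.

open import Defs
open import Data.Fin using (zero; suc)
open import Data.Fin.Substitution using (Lift; Sub; Subs; TermSubst)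
open import Data.Fin.Substitution.Lemmas using (TermLemmas)
open import Data.Nat using (ℕ; suc)
open import Data.Product using (_×_; _,_; ∃-syntax; proj₁; proj₂)
open import Data.Sign using (Sign; +; -; opposite)
open import Data.Vec using (_∷_; lookup; map)
open import Data.Vec.Properties using (lookup-map)
open import Data.Vec.Relation.Binary.Pointwise.Inductive as Pointwise using (Pointwise; _∷_)
open import Relation.Binary.Construct.Closure.ReflexiveTransitive as Star
  using (Star; ε; _◅_; _◅◅_; gmap)
open import Relation.Binary.PropositionalEquality
  using (_≡_; refl; sym; trans; cong; cong₂; subst; subst₂)
open import Relation.Binary.Rewriting using (Confluent)

private
  variable
    m n : ℕ

-- Substitution calculus on raw terms

module _ {T : ℕ → Set} (l : Lift T Term) where
  open TermSubst.Lifted termSubst l using (_↑✶_; _/✶_) renaming (_/_ to _/ₗ_)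

  -- Here and in the lemmas below, a single substitution passes through the constructor by
  -- definition. A list is folded one substitution at a time, so induction on it suffices; `k`
  -- counts the binders already crossed.
  ▶◀-/✶ : ∀ k {t Q s} (ρs : Subs T m n) →
          (t ▶◀[ Q ] s) /✶ ρs ↑✶ k ≡ (t /✶ ρs ↑✶ k) ▶◀[ Q ] (s /✶ ρs ↑✶ k)
  ▶◀-/✶ k ε        = refl
  ▶◀-/✶ k (ρ ◅ ρs) = cong (_/ₗ _) (▶◀-/✶ k ρs)

  pair-/✶ : ∀ k {σ t s} (ρs : Subs T m n) →
            pair σ t s /✶ ρs ↑✶ k ≡ pair σ (t /✶ ρs ↑✶ k) (s /✶ ρs ↑✶ k)
  pair-/✶ k ε        = refl
  pair-/✶ k (ρ ◅ ρs) = cong (_/ₗ _) (pair-/✶ k ρs)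

  π-/✶ : ∀ k {σ i t} (ρs : Subs T m n) →
         π σ i t /✶ ρs ↑✶ k ≡ π σ i (t /✶ ρs ↑✶ k)
  π-/✶ k ε        = refl
  π-/✶ k (ρ ◅ ρs) = cong (_/ₗ _) (π-/✶ k ρs)

  inj-/✶ : ∀ k {σ i t} (ρs : Subs T m n) →
           inj σ i t /✶ ρs ↑✶ k ≡ inj σ i (t /✶ ρs ↑✶ k)
  inj-/✶ k ε        = refl
  inj-/✶ k (ρ ◅ ρs) = cong (_/ₗ _) (inj-/✶ k ρs)

  δ-/✶ : ∀ k {σ t P s Q u} (ρs : Subs T m n) →
         δ σ t P s Q u /✶ ρs ↑✶ k ≡
         δ σ (t /✶ ρs ↑✶ k) P (s /✶ ρs ↑✶ suc k) Q (u /✶ ρs ↑✶ suc k)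
  δ-/✶ k ε        = refl
  δ-/✶ k (ρ ◅ ρs) = cong (_/ₗ _) (δ-/✶ k ρs)

  ν-/✶ : ∀ k {σ t} (ρs : Subs T m n) → ν σ t /✶ ρs ↑✶ k ≡ ν σ (t /✶ ρs ↑✶ k)
  ν-/✶ k ε        = refl
  ν-/✶ k (ρ ◅ ρs) = cong (_/ₗ _) (ν-/✶ k ρs)

  μ-/✶ : ∀ k {σ t} (ρs : Subs T m n) → μ σ t /✶ ρs ↑✶ k ≡ μ σ (t /✶ ρs ↑✶ k)
  μ-/✶ k ε        = refl
  μ-/✶ k (ρ ◅ ρs) = cong (_/ₗ _) (μ-/✶ k ρs)

  IC-/✶ : ∀ k {σ P t} (ρs : Subs T m n) →
          IC σ P t /✶ ρs ↑✶ k ≡ IC σ P (t /✶ ρs ↑✶ suc k)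
  IC-/✶ k ε        = refl
  IC-/✶ k (ρ ◅ ρs) = cong (_/ₗ _) (IC-/✶ k ρs)

  ●-/✶ : ∀ k {t σ s} (ρs : Subs T m n) →
         (t ●[ σ ] s) /✶ ρs ↑✶ k ≡ (t /✶ ρs ↑✶ k) ●[ σ ] (s /✶ ρs ↑✶ k)
  ●-/✶ k ε        = refl
  ●-/✶ k (ρ ◅ ρs) = cong (_/ₗ _) (●-/✶ k ρs)

module _ {T₁ T₂ : ℕ → Set} {l₁ : Lift T₁ Term} {l₂ : Lift T₂ Term} where
  open TermSubst.Lifted termSubst l₁ using ()
    renaming (_↑✶_ to _↑✶₁_; _/✶_ to _/✶₁_)
  open TermSubst.Lifted termSubst l₂ using ()
    renaming (_↑✶_ to _↑✶₂_; _/✶_ to _/✶₂_)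

  -- The main obligation of `TermLemmas`, which then yields `sub-commutes` and `/-wk`. Entries on
  -- the two sides may be of different kinds, so that renamings can be compared with substitutions.
  -- Agreement on variables is assumed at every depth because `δ` and `IC` raise `k`.
  /✶-↑✶-cong : (ρs₁ : Subs T₁ m n) (ρs₂ : Subs T₂ m n) →
               (∀ k x → var x /✶₁ ρs₁ ↑✶₁ k ≡ var x /✶₂ ρs₂ ↑✶₂ k) →
               ∀ k t → t /✶₁ ρs₁ ↑✶₁ k ≡ t /✶₂ ρs₂ ↑✶₂ k
  /✶-↑✶-cong ρs₁ ρs₂ hyp = go
    where
    go : ∀ k t → t /✶₁ ρs₁ ↑✶₁ k ≡ t /✶₂ ρs₂ ↑✶₂ k
    go k (var x)         = hyp k x
    go k (t ▶◀[ Q ] s)   = trans (▶◀-/✶ l₁ k ρs₁)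
      (trans (cong₂ _▶◀[ Q ]_ (go k t) (go k s)) (sym (▶◀-/✶ l₂ k ρs₂)))
    go k (pair σ t s)    = trans (pair-/✶ l₁ k ρs₁)
      (trans (cong₂ (pair σ) (go k t) (go k s)) (sym (pair-/✶ l₂ k ρs₂)))
    go k (π σ i t)       = trans (π-/✶ l₁ k ρs₁)
      (trans (cong (π σ i) (go k t)) (sym (π-/✶ l₂ k ρs₂)))
    go k (inj σ i t)     = trans (inj-/✶ l₁ k ρs₁)
      (trans (cong (inj σ i) (go k t)) (sym (inj-/✶ l₂ k ρs₂)))
    go k (δ σ t P s Q u) = trans (δ-/✶ l₁ k ρs₁)
      (trans (cong₂ (λ t′ su → δ σ t′ P (proj₁ su) Q (proj₂ su)) (go k t)
               (cong₂ _,_ (go (suc k) s) (go (suc k) u)))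
        (sym (δ-/✶ l₂ k ρs₂)))
    go k (ν σ t)         = trans (ν-/✶ l₁ k ρs₁)
      (trans (cong (ν σ) (go k t)) (sym (ν-/✶ l₂ k ρs₂)))
    go k (μ σ t)         = trans (μ-/✶ l₁ k ρs₁)
      (trans (cong (μ σ) (go k t)) (sym (μ-/✶ l₂ k ρs₂)))
    go k (IC σ P t)      = trans (IC-/✶ l₁ k ρs₁)
      (trans (cong (IC σ P) (go (suc k) t)) (sym (IC-/✶ l₂ k ρs₂)))
    go k (t ●[ σ ] s)    = trans (●-/✶ l₁ k ρs₁)
      (trans (cong₂ _●[ σ ]_ (go k t) (go k s)) (sym (●-/✶ l₂ k ρs₂)))

termLemmas : TermLemmas Term
termLemmas = record
  { termSubst = termSubst
  ; app-var   = refl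
  ; /✶-↑✶     = /✶-↑✶-cong
  }

open TermLemmas termLemmas using (sub-commutes; /-wk)
open TermSubst termSubst using (_↑; weaken; wk; termLift; varLift)

-- Typing

-- The judgement that typed substitutions need on their entries, which are
-- variables for renamings and terms for substitutions proper.
record TypedLift {T : ℕ → Set} (l : Lift T Term) : Set₁ where
  open Lift l using () renaming (var to varₗ; weaken to weakenₗ; lift to liftₗ)
  infix 4 _⊩_∶_
  field
    _⊩_∶_    : Ctx n → T n → Type → Set
    var-⊩    : ∀ {Γ : Ctx n} x → Γ ⊩ varₗ x ∶ lookup Γ x
    weaken-⊩ : ∀ {Γ : Ctx n} {t P Q} → Γ ⊩ t ∶ P → Q ∷ Γ ⊩ weakenₗ t ∶ P
    lift-⊢   : ∀ {Γ : Ctx n} {t P} → Γ ⊩ t ∶ P → Γ ⊢ liftₗ t ∶ P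

module TypedSubst {T : ℕ → Set} {l : Lift T Term} (tl : TypedLift l) where
  open TypedLift tl
  open Lift l using ()
    renaming (_↑ to _↑ₗ; id to idₗ; wk to wkₗ; weaken to weakenₗ; sub to subₗ)
  open TermApp l using () renaming (_/_ to _/ₗ_)

  infix 4 _⊩_⇒_
  _⊩_⇒_ : Ctx n → Sub T m n → Ctx m → Set
  Δ ⊩ ρ ⇒ Γ = ∀ x → Δ ⊩ lookup ρ x ∶ lookup Γ x

  weaken-⇒ : ∀ {Δ : Ctx n} {ρ : Sub T m n} {Γ P} →
             Δ ⊩ ρ ⇒ Γ → P ∷ Δ ⊩ map weakenₗ ρ ⇒ Γ
  weaken-⇒ {ρ = ρ} ⊩ρ x =
    subst (_ ⊩_∶ _) (sym (lookup-map x weakenₗ ρ)) (weaken-⊩ (⊩ρ x))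

  ↑-⇒ : ∀ {Δ : Ctx n} {ρ : Sub T m n} {Γ P} → Δ ⊩ ρ ⇒ Γ → P ∷ Δ ⊩ ρ ↑ₗ ⇒ P ∷ Γ
  ↑-⇒             ⊩ρ zero    = var-⊩ zero
  ↑-⇒ {ρ = ρ} {Γ} ⊩ρ (suc x) = weaken-⇒ {ρ = ρ} {Γ} ⊩ρ x

  id-⇒ : (Γ : Ctx n) → Γ ⊩ idₗ ⇒ Γ
  id-⇒ (P ∷ Γ) = ↑-⇒ {ρ = idₗ} (id-⇒ Γ)

  wk-⇒ : ∀ {Γ : Ctx n} {P} → P ∷ Γ ⊩ wkₗ ⇒ Γ
  wk-⇒ {Γ = Γ} = weaken-⇒ {ρ = idₗ} {Γ} (id-⇒ Γ)

  sub-⇒ : ∀ {Γ : Ctx n} {t P} → Γ ⊩ t ∶ P → Γ ⊩ subₗ t ⇒ P ∷ Γ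
  sub-⇒         ⊩t zero    = ⊩t
  sub-⇒ {Γ = Γ} ⊩t (suc x) = id-⇒ Γ x

  /-⊢ : ∀ {Γ : Ctx m} {Δ : Ctx n} {t P ρ} → Δ ⊩ ρ ⇒ Γ → Γ ⊢ t ∶ P → Δ ⊢ t /ₗ ρ ∶ P
  /-⊢ ⊩ρ (ax x)           = lift-⊢ (⊩ρ x)
  /-⊢ ⊩ρ (abs p ⊢t ⊢s)    = abs p (/-⊢ ⊩ρ ⊢t) (/-⊢ ⊩ρ ⊢s)
  /-⊢ ⊩ρ (pair⁺ ⊢t ⊢s)    = pair⁺ (/-⊢ ⊩ρ ⊢t) (/-⊢ ⊩ρ ⊢s)
  /-⊢ ⊩ρ (pair⁻ ⊢t ⊢s)    = pair⁻ (/-⊢ ⊩ρ ⊢t) (/-⊢ ⊩ρ ⊢s)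
  /-⊢ ⊩ρ (π⁺ i ⊢t)        = π⁺ i (/-⊢ ⊩ρ ⊢t)
  /-⊢ ⊩ρ (π⁻ i ⊢t)        = π⁻ i (/-⊢ ⊩ρ ⊢t)
  /-⊢ ⊩ρ (inj⁺ i ⊢t)      = inj⁺ i (/-⊢ ⊩ρ ⊢t)
  /-⊢ ⊩ρ (inj⁻ i ⊢t)      = inj⁻ i (/-⊢ ⊩ρ ⊢t)
  /-⊢ ⊩ρ (δ⁺ ⊢t ⊢s ⊢u)    = δ⁺ (/-⊢ ⊩ρ ⊢t) (/-⊢ (↑-⇒ ⊩ρ) ⊢s) (/-⊢ (↑-⇒ ⊩ρ) ⊢u)
  /-⊢ ⊩ρ (δ⁻ ⊢t ⊢s ⊢u)    = δ⁻ (/-⊢ ⊩ρ ⊢t) (/-⊢ (↑-⇒ ⊩ρ) ⊢s) (/-⊢ (↑-⇒ ⊩ρ) ⊢u)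
  /-⊢ ⊩ρ (ν⁺ ⊢t)          = ν⁺ (/-⊢ ⊩ρ ⊢t)
  /-⊢ ⊩ρ (ν⁻ ⊢t)          = ν⁻ (/-⊢ ⊩ρ ⊢t)
  /-⊢ ⊩ρ (μ⁺ ⊢t)          = μ⁺ (/-⊢ ⊩ρ ⊢t)
  /-⊢ ⊩ρ (μ⁻ ⊢t)          = μ⁻ (/-⊢ ⊩ρ ⊢t)
  /-⊢ ⊩ρ (IC⁺ ⊢t)         = IC⁺ (/-⊢ (↑-⇒ ⊩ρ) ⊢t)
  /-⊢ ⊩ρ (IC⁻ ⊢t)         = IC⁻ (/-⊢ (↑-⇒ ⊩ρ) ⊢t)
  /-⊢ ⊩ρ (app⁺ ⊢t ⊢s)     = app⁺ (/-⊢ ⊩ρ ⊢t) (/-⊢ ⊩ρ ⊢s)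
  /-⊢ ⊩ρ (app⁻ ⊢t ⊢s)     = app⁻ (/-⊢ ⊩ρ ⊢t) (/-⊢ ⊩ρ ⊢s)

typedVarLift : TypedLift varLift
typedVarLift = record
  { _⊩_∶_    = λ Γ x P → lookup Γ x ≡ P
  ; var-⊩    = λ _ → refl
  -- Weakening a variable is `suc`, and its lookup in the extended context reduces to the old one.
  ; weaken-⊩ = λ eq → eq
  ; lift-⊢   = λ { refl → ax _ }
  }

typedTermLift : TypedLift termLift
typedTermLift = record
  { _⊩_∶_    = _⊢_∶_
  ; var-⊩    = ax
  -- Terms are weakened by renaming, so the variable instance of `/-⊢` supplies what the term
  -- instance needs.
  ; weaken-⊩ = V./-⊢ V.wk-⇒
  ; lift-⊢   = λ ⊢t → ⊢t
  }
  where module V = TypedSubst typedVarLift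

sub-⊢ : ∀ {Γ : Ctx n} {t s P Q} → P ∷ Γ ⊢ t ∶ Q → Γ ⊢ s ∶ P → Γ ⊢ t / sub s ∶ Q
sub-⊢ ⊢t ⊢s = /-⊢ (sub-⇒ ⊢s) ⊢t
  where open TypedSubst typedTermLift

choose-⊢ : ∀ {Γ : Ctx n} {t s A B} (C : Form → Type) i →
           Γ ⊢ t ∶ C A → Γ ⊢ s ∶ C B → Γ ⊢ choose i t s ∶ C (choose i A B)
choose-⊢ C zero       ⊢t ⊢s = ⊢t
choose-⊢ C (suc zero) ⊢t ⊢s = ⊢s

-- A term may have several types, since inj does not record the other summand,
-- but they all have the same mode, and ⋈ depends on nothing else.
⋈-unique : ∀ {Γ : Ctx n} {t P P′} → Γ ⊢ t ∶ P → Γ ⊢ t ∶ P′ →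
           ∀ {Q} (u s : Term m) → u ⋈[ P , Q ] s ≡ u ⋈[ P′ , Q ] s
⋈-unique (ax x)       (ax .x)      u s = refl
⋈-unique (abs _ _ _)  (abs _ _ _)  u s = refl
⋈-unique (pair⁺ _ _)  (pair⁺ _ _)  u s = refl
⋈-unique (pair⁻ _ _)  (pair⁻ _ _)  u s = refl
⋈-unique (π⁺ _ _)     (π⁺ _ _)     u s = refl
⋈-unique (π⁻ _ _)     (π⁻ _ _)     u s = refl
⋈-unique (inj⁺ _ _)   (inj⁺ _ _)   u s = refl
⋈-unique (inj⁻ _ _)   (inj⁻ _ _)   u s = refl
-- The annotation fixes the branch context in both typings. The operands `u` and `s` live in a scope
-- of their own, so the recursion can go under the binder.
⋈-unique (δ⁺ _ d _)   (δ⁺ _ e _)   u s = ⋈-unique d e u s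
⋈-unique (δ⁻ _ d _)   (δ⁻ _ e _)   u s = ⋈-unique d e u s
⋈-unique (ν⁺ _)       (ν⁺ _)       u s = refl
⋈-unique (ν⁻ _)       (ν⁻ _)       u s = refl
⋈-unique (μ⁺ _)       (μ⁺ _)       u s = refl
⋈-unique (μ⁻ _)       (μ⁻ _)       u s = refl
⋈-unique (IC⁺ _)      (IC⁺ _)      u s = refl
⋈-unique (IC⁻ _)      (IC⁻ _)      u s = refl
⋈-unique (app⁺ _ _)   (app⁺ _ _)   u s = refl
⋈-unique (app⁻ _ _)   (app⁻ _ _)   u s = refl

-- Parallel reduction

-- This is `_⋈[_,_]_` at a type `A ⊕` for `+` and `A ⊖` for `-`. Operands of `pair`, `inj` and `ν`
-- are classical in a typable term, so every absurdity redex contracts to this form.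
absurd : Sign → Type → Term n → Term n → Term n
absurd σ Q t s = (t ●[ σ ] s) ▶◀[ Q ] (s ●[ opposite σ ] t)

-- An operand of pair σ or inj σ has mode ⊕ if σ = + and ⊖ if σ = -, an operand
-- of ν σ the opposite one; this fixes the sign in the last three contracta.
infix 4 _⇛_

data _⇛_ {n : ℕ} : Term n → Term n → Set where
  ⇛-var      : ∀ {x} → var x ⇛ var x
  ⇛-▶◀       : ∀ {t t′ Q s s′} → t ⇛ t′ → s ⇛ s′ → t ▶◀[ Q ] s ⇛ t′ ▶◀[ Q ] s′
  ⇛-pair     : ∀ {σ t t′ s s′} → t ⇛ t′ → s ⇛ s′ → pair σ t s ⇛ pair σ t′ s′
  ⇛-π        : ∀ {σ i t t′} → t ⇛ t′ → π σ i t ⇛ π σ i t′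
  ⇛-inj      : ∀ {σ i t t′} → t ⇛ t′ → inj σ i t ⇛ inj σ i t′
  ⇛-δ        : ∀ {σ t t′ P s s′ Q u u′} → t ⇛ t′ → s ⇛ s′ → u ⇛ u′ →
               δ σ t P s Q u ⇛ δ σ t′ P s′ Q u′
  ⇛-ν        : ∀ {σ t t′} → t ⇛ t′ → ν σ t ⇛ ν σ t′
  ⇛-μ        : ∀ {σ t t′} → t ⇛ t′ → μ σ t ⇛ μ σ t′
  ⇛-IC       : ∀ {σ P t t′} → t ⇛ t′ → IC σ P t ⇛ IC σ P t′
  ⇛-●        : ∀ {σ t t′ s s′} → t ⇛ t′ → s ⇛ s′ → t ●[ σ ] s ⇛ t′ ●[ σ ] s′
  ⇛-π-pair   : ∀ {σ i t t′ s s′} → t ⇛ t′ → s ⇛ s′ →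
               π σ i (pair σ t s) ⇛ choose i t′ s′
  ⇛-δ-inj    : ∀ {σ i t t′ P s s′ Q u u′} → t ⇛ t′ → s ⇛ s′ → u ⇛ u′ →
               δ σ (inj σ i t) P s Q u ⇛ choose i s′ u′ / sub t′
  ⇛-μ-ν      : ∀ {σ t t′} → t ⇛ t′ → μ σ (ν σ t) ⇛ t′
  ⇛-IC-●     : ∀ {σ P t t′ s s′} → t ⇛ t′ → s ⇛ s′ →
               IC σ P t ●[ σ ] s ⇛ t′ / sub s′
  ⇛-pair-inj : ∀ {σ i Q t t′ s s′ u u′} → t ⇛ t′ → s ⇛ s′ → u ⇛ u′ →
               pair σ t s ▶◀[ Q ] inj (opposite σ) i u
                 ⇛ absurd σ Q (choose i t′ s′) u′
  ⇛-inj-pair : ∀ {σ i Q t t′ s s′ u u′} → t ⇛ t′ → s ⇛ s′ → u ⇛ u′ →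
               inj σ i t ▶◀[ Q ] pair (opposite σ) s u
                 ⇛ absurd σ Q t′ (choose i s′ u′)
  ⇛-ν-ν      : ∀ {σ Q t t′ s s′} → t ⇛ t′ → s ⇛ s′ →
               ν σ t ▶◀[ Q ] ν (opposite σ) s ⇛ absurd (opposite σ) Q t′ s′

⇛-refl : {t : Term n} → t ⇛ t
⇛-refl {t = var x}         = ⇛-var
⇛-refl {t = t ▶◀[ Q ] s}   = ⇛-▶◀ ⇛-refl ⇛-refl
⇛-refl {t = pair σ t s}    = ⇛-pair ⇛-refl ⇛-refl
⇛-refl {t = π σ i t}       = ⇛-π ⇛-refl
⇛-refl {t = inj σ i t}     = ⇛-inj ⇛-refl
⇛-refl {t = δ σ t P s Q u} = ⇛-δ ⇛-refl ⇛-refl ⇛-refl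
⇛-refl {t = ν σ t}         = ⇛-ν ⇛-refl
⇛-refl {t = μ σ t}         = ⇛-μ ⇛-refl
⇛-refl {t = IC σ P t}      = ⇛-IC ⇛-refl
⇛-refl {t = t ●[ σ ] s}    = ⇛-● ⇛-refl ⇛-refl

choose-⇛ : ∀ i {t t′ s s′ : Term n} → t ⇛ t′ → s ⇛ s′ →
           choose i t s ⇛ choose i t′ s′
choose-⇛ zero       d e = d
choose-⇛ (suc zero) d e = e

absurd-⇛ : ∀ {σ Q} {t t′ s s′ : Term n} → t ⇛ t′ → s ⇛ s′ →
           absurd σ Q t s ⇛ absurd σ Q t′ s′
absurd-⇛ d e = ⇛-▶◀ (⇛-● d e) (⇛-● e d)

choose-natural : ∀ {X Y : Set} (f : X → Y) i {x y} →
                 choose i (f x) (f y) ≡ f (choose i x y)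
choose-natural f zero       = refl
choose-natural f (suc zero) = refl

-- Weakening is itself a substitution, and the substitution lemma for ⇛ on terms
-- needs stability of ⇛ under weakening first. Both are instances of this lemma.
module SubstCompat
  (_≈_ : ∀ {m n} → Sub Term m n → Sub Term m n → Set)
  (≈-↑ : ∀ {m n} {ρ ρ′ : Sub Term m n} → ρ ≈ ρ′ → (ρ ↑) ≈ (ρ′ ↑))
  (≈-⇛ : ∀ {m n} {ρ ρ′ : Sub Term m n} → ρ ≈ ρ′ → ∀ x → lookup ρ x ⇛ lookup ρ′ x)
  where

  /-⇛ : ∀ {t t′ : Term m} {ρ ρ′ : Sub Term m n} → t ⇛ t′ → ρ ≈ ρ′ → t / ρ ⇛ t′ / ρ′
  /-⇛ ⇛-var              r = ≈-⇛ r _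
  /-⇛ (⇛-▶◀ d e)         r = ⇛-▶◀ (/-⇛ d r) (/-⇛ e r)
  /-⇛ (⇛-pair d e)       r = ⇛-pair (/-⇛ d r) (/-⇛ e r)
  /-⇛ (⇛-π d)            r = ⇛-π (/-⇛ d r)
  /-⇛ (⇛-inj d)          r = ⇛-inj (/-⇛ d r)
  /-⇛ (⇛-δ d e f)        r = ⇛-δ (/-⇛ d r) (/-⇛ e (≈-↑ r)) (/-⇛ f (≈-↑ r))
  /-⇛ (⇛-ν d)            r = ⇛-ν (/-⇛ d r)
  /-⇛ (⇛-μ d)            r = ⇛-μ (/-⇛ d r)
  /-⇛ (⇛-IC d)           r = ⇛-IC (/-⇛ d (≈-↑ r))
  /-⇛ (⇛-● d e)          r = ⇛-● (/-⇛ d r) (/-⇛ e r)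
  /-⇛ {ρ′ = ρ′} (⇛-π-pair {i = i} d e) r =
    subst (_ ⇛_) (choose-natural (_/ ρ′) i) (⇛-π-pair (/-⇛ d r) (/-⇛ e r))
  /-⇛ {ρ′ = ρ′} (⇛-δ-inj {i = i} {s′ = s′} {u′ = u′} d e f) r =
    subst (_ ⇛_)
      -- The substitution lemma: instantiating and then applying `ρ′` equals applying `ρ′ ↑` and
      -- then instantiating with the substituted argument.
      (trans (cong (_/ sub _) (choose-natural (_/ ρ′ ↑) i))
             (sym (sub-commutes (choose i s′ u′))))
      (⇛-δ-inj (/-⇛ d r) (/-⇛ e (≈-↑ r)) (/-⇛ f (≈-↑ r)))
  /-⇛ (⇛-μ-ν d)          r = ⇛-μ-ν (/-⇛ d r)
  /-⇛ (⇛-IC-● {t′ = t′} d e) r =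
    subst (_ ⇛_) (sym (sub-commutes t′)) (⇛-IC-● (/-⇛ d (≈-↑ r)) (/-⇛ e r))
  /-⇛ {ρ′ = ρ′} (⇛-pair-inj {i = i} d e f) r =
    subst (λ v → _ ⇛ absurd _ _ v _) (choose-natural (_/ ρ′) i)
      (⇛-pair-inj (/-⇛ d r) (/-⇛ e r) (/-⇛ f r))
  /-⇛ {ρ′ = ρ′} (⇛-inj-pair {i = i} d e f) r =
    subst (λ v → _ ⇛ absurd _ _ _ v) (choose-natural (_/ ρ′) i)
      (⇛-inj-pair (/-⇛ d r) (/-⇛ e r) (/-⇛ f r))
  /-⇛ (⇛-ν-ν d e)        r = ⇛-ν-ν (/-⇛ d r) (/-⇛ e r)

≡⇒lookup-⇛ : {ρ ρ′ : Sub Term m n} → ρ ≡ ρ′ → ∀ x → lookup ρ x ⇛ lookup ρ′ x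
≡⇒lookup-⇛ refl x = ⇛-refl

weaken-⇛ : ∀ {t t′ : Term n} → t ⇛ t′ → weaken t ⇛ weaken t′
weaken-⇛ {t = t} {t′} d = subst₂ _⇛_ (/-wk {t = t}) (/-wk {t = t′}) (/-⇛ {ρ = wk} d refl)
  -- Equality of substitutions lifts by congruence, so this instance does not presuppose stability
  -- under weakening.
  where open SubstCompat _≡_ (cong _↑) ≡⇒lookup-⇛

sub-⇛ : ∀ {t t′ : Term (suc n)} {s s′} → t ⇛ t′ → s ⇛ s′ → t / sub s ⇛ t′ / sub s′
sub-⇛ d e = /-⇛ d (e ∷ Pointwise.refl ⇛-refl)
  where
  -- Lifting weakens every entry, which is where `weaken-⇛` enters.
  open SubstCompat (Pointwise _⇛_)
    (λ r → ⇛-var ∷ Pointwise.map⁺ weaken-⇛ r) Pointwise.lookup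

-- Diamond property and confluence of parallel reduction

infix 4 _⇛*_

_⇛*_ : Term n → Term n → Set
_⇛*_ = Star _⇛_

-- The constructors that meet in a redex (`pair`, `inj`, `ν`, `IC`) step only inside, so a
-- congruence step leaves the redex in place. Two steps from a redex therefore either use the same
-- contraction or differ only in whether they contract it, and the parts are joined by induction.
⇛-diamond : ∀ {t u v : Term n} → t ⇛ u → t ⇛ v → ∃[ w ] ((u ⇛ w) × (v ⇛ w))
⇛-diamond ⇛-var ⇛-var = _ , ⇛-var , ⇛-var
⇛-diamond (⇛-▶◀ d e) (⇛-▶◀ d′ e′)
  with _ , p , p′ ← ⇛-diamond d d′ | _ , q , q′ ← ⇛-diamond e e′
  = _ , ⇛-▶◀ p q , ⇛-▶◀ p′ q′
-- One side still has the redex and contracts it while joining the parts; the other joins the parts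
-- inside its contractum. The remaining mixed cases follow this pattern.
⇛-diamond (⇛-▶◀ (⇛-pair d e) (⇛-inj f)) (⇛-pair-inj {i = i} d′ e′ f′)
  with _ , p , p′ ← ⇛-diamond d d′ | _ , q , q′ ← ⇛-diamond e e′
     | _ , r , r′ ← ⇛-diamond f f′
  = _ , ⇛-pair-inj p q r , absurd-⇛ (choose-⇛ i p′ q′) r′
⇛-diamond (⇛-▶◀ (⇛-inj d) (⇛-pair e f)) (⇛-inj-pair {i = i} d′ e′ f′)
  with _ , p , p′ ← ⇛-diamond d d′ | _ , q , q′ ← ⇛-diamond e e′
     | _ , r , r′ ← ⇛-diamond f f′
  = _ , ⇛-inj-pair p q r , absurd-⇛ p′ (choose-⇛ i q′ r′)
⇛-diamond (⇛-▶◀ (⇛-ν d) (⇛-ν e)) (⇛-ν-ν d′ e′)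
  with _ , p , p′ ← ⇛-diamond d d′ | _ , q , q′ ← ⇛-diamond e e′
  = _ , ⇛-ν-ν p q , absurd-⇛ p′ q′
⇛-diamond (⇛-pair d e) (⇛-pair d′ e′)
  with _ , p , p′ ← ⇛-diamond d d′ | _ , q , q′ ← ⇛-diamond e e′
  = _ , ⇛-pair p q , ⇛-pair p′ q′
⇛-diamond (⇛-π d) (⇛-π d′)
  with _ , p , p′ ← ⇛-diamond d d′ = _ , ⇛-π p , ⇛-π p′
⇛-diamond (⇛-π (⇛-pair d e)) (⇛-π-pair {i = i} d′ e′)
  with _ , p , p′ ← ⇛-diamond d d′ | _ , q , q′ ← ⇛-diamond e e′
  = _ , ⇛-π-pair p q , choose-⇛ i p′ q′
⇛-diamond (⇛-inj d) (⇛-inj d′)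
  with _ , p , p′ ← ⇛-diamond d d′ = _ , ⇛-inj p , ⇛-inj p′
⇛-diamond (⇛-δ d e f) (⇛-δ d′ e′ f′)
  with _ , p , p′ ← ⇛-diamond d d′ | _ , q , q′ ← ⇛-diamond e e′
     | _ , r , r′ ← ⇛-diamond f f′
  = _ , ⇛-δ p q r , ⇛-δ p′ q′ r′
⇛-diamond (⇛-δ (⇛-inj d) e f) (⇛-δ-inj {i = i} d′ e′ f′)
  with _ , p , p′ ← ⇛-diamond d d′ | _ , q , q′ ← ⇛-diamond e e′
     | _ , r , r′ ← ⇛-diamond f f′
  = _ , ⇛-δ-inj p q r , sub-⇛ (choose-⇛ i q′ r′) p′
⇛-diamond (⇛-ν d) (⇛-ν d′)
  with _ , p , p′ ← ⇛-diamond d d′ = _ , ⇛-ν p , ⇛-ν p′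
⇛-diamond (⇛-μ d) (⇛-μ d′)
  with _ , p , p′ ← ⇛-diamond d d′ = _ , ⇛-μ p , ⇛-μ p′
⇛-diamond (⇛-μ (⇛-ν d)) (⇛-μ-ν d′)
  with _ , p , p′ ← ⇛-diamond d d′ = _ , ⇛-μ-ν p , p′
⇛-diamond (⇛-IC d) (⇛-IC d′)
  with _ , p , p′ ← ⇛-diamond d d′ = _ , ⇛-IC p , ⇛-IC p′
⇛-diamond (⇛-● d e) (⇛-● d′ e′)
  with _ , p , p′ ← ⇛-diamond d d′ | _ , q , q′ ← ⇛-diamond e e′
  = _ , ⇛-● p q , ⇛-● p′ q′
⇛-diamond (⇛-● (⇛-IC d) e) (⇛-IC-● d′ e′)
  with _ , p , p′ ← ⇛-diamond d d′ | _ , q , q′ ← ⇛-diamond e e′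
  = _ , ⇛-IC-● p q , sub-⇛ p′ q′
⇛-diamond (⇛-π-pair {i = i} d e) (⇛-π (⇛-pair d′ e′))
  with _ , p , p′ ← ⇛-diamond d d′ | _ , q , q′ ← ⇛-diamond e e′
  = _ , choose-⇛ i p q , ⇛-π-pair p′ q′
⇛-diamond (⇛-π-pair {i = i} d e) (⇛-π-pair d′ e′)
  with _ , p , p′ ← ⇛-diamond d d′ | _ , q , q′ ← ⇛-diamond e e′
  = _ , choose-⇛ i p q , choose-⇛ i p′ q′
⇛-diamond (⇛-δ-inj {i = i} d e f) (⇛-δ (⇛-inj d′) e′ f′)
  with _ , p , p′ ← ⇛-diamond d d′ | _ , q , q′ ← ⇛-diamond e e′
     | _ , r , r′ ← ⇛-diamond f f′
  = _ , sub-⇛ (choose-⇛ i q r) p , ⇛-δ-inj p′ q′ r′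
⇛-diamond (⇛-δ-inj {i = i} d e f) (⇛-δ-inj d′ e′ f′)
  with _ , p , p′ ← ⇛-diamond d d′ | _ , q , q′ ← ⇛-diamond e e′
     | _ , r , r′ ← ⇛-diamond f f′
  = _ , sub-⇛ (choose-⇛ i q r) p , sub-⇛ (choose-⇛ i q′ r′) p′
⇛-diamond (⇛-μ-ν d) (⇛-μ (⇛-ν d′))
  with _ , p , p′ ← ⇛-diamond d d′ = _ , p , ⇛-μ-ν p′
⇛-diamond (⇛-μ-ν d) (⇛-μ-ν d′) = ⇛-diamond d d′
⇛-diamond (⇛-IC-● d e) (⇛-● (⇛-IC d′) e′)
  with _ , p , p′ ← ⇛-diamond d d′ | _ , q , q′ ← ⇛-diamond e e′
  = _ , sub-⇛ p q , ⇛-IC-● p′ q′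
⇛-diamond (⇛-IC-● d e) (⇛-IC-● d′ e′)
  with _ , p , p′ ← ⇛-diamond d d′ | _ , q , q′ ← ⇛-diamond e e′
  = _ , sub-⇛ p q , sub-⇛ p′ q′
⇛-diamond (⇛-pair-inj {i = i} d e f) (⇛-▶◀ (⇛-pair d′ e′) (⇛-inj f′))
  with _ , p , p′ ← ⇛-diamond d d′ | _ , q , q′ ← ⇛-diamond e e′
     | _ , r , r′ ← ⇛-diamond f f′
  = _ , absurd-⇛ (choose-⇛ i p q) r , ⇛-pair-inj p′ q′ r′
⇛-diamond (⇛-pair-inj {i = i} d e f) (⇛-pair-inj d′ e′ f′)
  with _ , p , p′ ← ⇛-diamond d d′ | _ , q , q′ ← ⇛-diamond e e′
     | _ , r , r′ ← ⇛-diamond f f′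
  = _ , absurd-⇛ (choose-⇛ i p q) r , absurd-⇛ (choose-⇛ i p′ q′) r′
⇛-diamond (⇛-inj-pair {i = i} d e f) (⇛-▶◀ (⇛-inj d′) (⇛-pair e′ f′))
  with _ , p , p′ ← ⇛-diamond d d′ | _ , q , q′ ← ⇛-diamond e e′
     | _ , r , r′ ← ⇛-diamond f f′
  = _ , absurd-⇛ p (choose-⇛ i q r) , ⇛-inj-pair p′ q′ r′
⇛-diamond (⇛-inj-pair {i = i} d e f) (⇛-inj-pair d′ e′ f′)
  with _ , p , p′ ← ⇛-diamond d d′ | _ , q , q′ ← ⇛-diamond e e′
     | _ , r , r′ ← ⇛-diamond f f′
  = _ , absurd-⇛ p (choose-⇛ i q r) , absurd-⇛ p′ (choose-⇛ i q′ r′)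
⇛-diamond (⇛-ν-ν d e) (⇛-▶◀ (⇛-ν d′) (⇛-ν e′))
  with _ , p , p′ ← ⇛-diamond d d′ | _ , q , q′ ← ⇛-diamond e e′
  = _ , absurd-⇛ p q , ⇛-ν-ν p′ q′
⇛-diamond (⇛-ν-ν d e) (⇛-ν-ν d′ e′)
  with _ , p , p′ ← ⇛-diamond d d′ | _ , q , q′ ← ⇛-diamond e e′
  = _ , absurd-⇛ p q , absurd-⇛ p′ q′

-- Diamonds are tiled along the second reduction. The opposite edge remains a single step, so
-- `⇛-confluent` can recurse on its first reduction and put that step in front.
⇛-strip : ∀ {t u v : Term n} → t ⇛ u → t ⇛* v → ∃[ w ] ((u ⇛* w) × (v ⇛ w))
⇛-strip d ε        = _ , ε , d
⇛-strip d (e ◅ es)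
  with _ , p , q ← ⇛-diamond d e
  with _ , ps , r ← ⇛-strip q es
  = _ , p ◅ ps , r

⇛-confluent : Confluent (_⇛_ {n})
⇛-confluent ε        es = _ , es , ε
⇛-confluent (d ◅ ds) es
  with _ , ps , q ← ⇛-strip d es
  with _ , rs , ss ← ⇛-confluent ds ps
  = _ , rs , q ◅ ss

-- Typed and parallel reduction

-- The typing matters at absurdity redexes. Inverting it gives an operand a classical type, at which
-- `⋈` unfolds to `absurd`; `⋈-unique` identifies this with `⋈` at the type chosen by the reduction
-- rule.
↝⇒⇛ : ∀ {Γ : Ctx n} {t t′ P} → Γ ⊢ t ∶ P → Γ ⊢ t ↝ t′ → t ⇛ t′
↝⇒⇛ ⊢t π-pair = ⇛-π-pair ⇛-refl ⇛-refl
↝⇒⇛ ⊢t δ-inj  = ⇛-δ-inj ⇛-refl ⇛-refl ⇛-refl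
↝⇒⇛ ⊢t μ-ν    = ⇛-μ-ν ⇛-refl
↝⇒⇛ ⊢t IC-●   = ⇛-IC-● ⇛-refl ⇛-refl
↝⇒⇛ (abs _ (pair⁺ ⊢t₁ ⊢t₂) _) (pair-inj {i = i} ⊢t _) =
  subst (_ ⇛_) (⋈-unique (choose-⊢ _⊕ i ⊢t₁ ⊢t₂) ⊢t _ _)
    (⇛-pair-inj ⇛-refl ⇛-refl ⇛-refl)
↝⇒⇛ (abs _ (pair⁻ ⊢t₁ ⊢t₂) _) (pair-inj {i = i} ⊢t _) =
  subst (_ ⇛_) (⋈-unique (choose-⊢ _⊖ i ⊢t₁ ⊢t₂) ⊢t _ _)
    (⇛-pair-inj ⇛-refl ⇛-refl ⇛-refl)
↝⇒⇛ (abs _ (inj⁺ _ ⊢t′) _) (inj-pair ⊢t _) =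
  subst (_ ⇛_) (⋈-unique ⊢t′ ⊢t _ _) (⇛-inj-pair ⇛-refl ⇛-refl ⇛-refl)
↝⇒⇛ (abs _ (inj⁻ _ ⊢t′) _) (inj-pair ⊢t _) =
  subst (_ ⇛_) (⋈-unique ⊢t′ ⊢t _ _) (⇛-inj-pair ⇛-refl ⇛-refl ⇛-refl)
↝⇒⇛ (abs _ (ν⁺ ⊢t′) _) (ν-ν ⊢t _) =
  subst (_ ⇛_) (⋈-unique ⊢t′ ⊢t _ _) (⇛-ν-ν ⇛-refl ⇛-refl)
↝⇒⇛ (abs _ (ν⁻ ⊢t′) _) (ν-ν ⊢t _) =
  subst (_ ⇛_) (⋈-unique ⊢t′ ⊢t _ _) (⇛-ν-ν ⇛-refl ⇛-refl)
↝⇒⇛ (abs _ ⊢t _)   (ξ-▶◀ˡ r)  = ⇛-▶◀ (↝⇒⇛ ⊢t r) ⇛-refl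
↝⇒⇛ (abs _ _ ⊢s)   (ξ-▶◀ʳ r)  = ⇛-▶◀ ⇛-refl (↝⇒⇛ ⊢s r)
↝⇒⇛ (pair⁺ ⊢t _)   (ξ-pairˡ r) = ⇛-pair (↝⇒⇛ ⊢t r) ⇛-refl
↝⇒⇛ (pair⁻ ⊢t _)   (ξ-pairˡ r) = ⇛-pair (↝⇒⇛ ⊢t r) ⇛-refl
↝⇒⇛ (pair⁺ _ ⊢s)   (ξ-pairʳ r) = ⇛-pair ⇛-refl (↝⇒⇛ ⊢s r)
↝⇒⇛ (pair⁻ _ ⊢s)   (ξ-pairʳ r) = ⇛-pair ⇛-refl (↝⇒⇛ ⊢s r)
↝⇒⇛ (π⁺ _ ⊢t)      (ξ-π r)     = ⇛-π (↝⇒⇛ ⊢t r)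
↝⇒⇛ (π⁻ _ ⊢t)      (ξ-π r)     = ⇛-π (↝⇒⇛ ⊢t r)
↝⇒⇛ (inj⁺ _ ⊢t)    (ξ-inj r)   = ⇛-inj (↝⇒⇛ ⊢t r)
↝⇒⇛ (inj⁻ _ ⊢t)    (ξ-inj r)   = ⇛-inj (↝⇒⇛ ⊢t r)
↝⇒⇛ (δ⁺ ⊢t _ _)    (ξ-δ r)     = ⇛-δ (↝⇒⇛ ⊢t r) ⇛-refl ⇛-refl
↝⇒⇛ (δ⁻ ⊢t _ _)    (ξ-δ r)     = ⇛-δ (↝⇒⇛ ⊢t r) ⇛-refl ⇛-refl
↝⇒⇛ (δ⁺ _ ⊢s _)    (ξ-δˡ r)    = ⇛-δ ⇛-refl (↝⇒⇛ ⊢s r) ⇛-refl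
↝⇒⇛ (δ⁻ _ ⊢s _)    (ξ-δˡ r)    = ⇛-δ ⇛-refl (↝⇒⇛ ⊢s r) ⇛-refl
↝⇒⇛ (δ⁺ _ _ ⊢u)    (ξ-δʳ r)    = ⇛-δ ⇛-refl ⇛-refl (↝⇒⇛ ⊢u r)
↝⇒⇛ (δ⁻ _ _ ⊢u)    (ξ-δʳ r)    = ⇛-δ ⇛-refl ⇛-refl (↝⇒⇛ ⊢u r)
↝⇒⇛ (ν⁺ ⊢t)        (ξ-ν r)     = ⇛-ν (↝⇒⇛ ⊢t r)
↝⇒⇛ (ν⁻ ⊢t)        (ξ-ν r)     = ⇛-ν (↝⇒⇛ ⊢t r)
↝⇒⇛ (μ⁺ ⊢t)        (ξ-μ r)     = ⇛-μ (↝⇒⇛ ⊢t r)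
↝⇒⇛ (μ⁻ ⊢t)        (ξ-μ r)     = ⇛-μ (↝⇒⇛ ⊢t r)
↝⇒⇛ (IC⁺ ⊢t)       (ξ-IC r)    = ⇛-IC (↝⇒⇛ ⊢t r)
↝⇒⇛ (IC⁻ ⊢t)       (ξ-IC r)    = ⇛-IC (↝⇒⇛ ⊢t r)
↝⇒⇛ (app⁺ ⊢t _)    (ξ-●ˡ r)    = ⇛-● (↝⇒⇛ ⊢t r) ⇛-refl
↝⇒⇛ (app⁻ ⊢t _)    (ξ-●ˡ r)    = ⇛-● (↝⇒⇛ ⊢t r) ⇛-refl
↝⇒⇛ (app⁺ _ ⊢s)    (ξ-●ʳ r)    = ⇛-● ⇛-refl (↝⇒⇛ ⊢s r)
↝⇒⇛ (app⁻ _ ⊢s)    (ξ-●ʳ r)    = ⇛-● ⇛-refl (↝⇒⇛ ⊢s r)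

-- Subject reduction

absurd-⊢⁺ : ∀ {Γ : Ctx n} {t s A Q} → Γ ⊢ t ∶ A ⊕ → Γ ⊢ s ∶ A ⊖ → Γ ⊢ absurd + Q t s ∶ Q
absurd-⊢⁺ ⊢t ⊢s = abs pos (app⁺ ⊢t ⊢s) (app⁻ ⊢s ⊢t)

absurd-⊢⁻ : ∀ {Γ : Ctx n} {t s A Q} → Γ ⊢ t ∶ A ⊖ → Γ ⊢ s ∶ A ⊕ → Γ ⊢ absurd - Q t s ∶ Q
absurd-⊢⁻ ⊢t ⊢s = abs neg (app⁻ ⊢t ⊢s) (app⁺ ⊢s ⊢t)

-- Inverting the typing of a redex fixes its sign and exposes typings of the parts. Their reducts
-- are typed by induction and reassembled, by `sub-⊢` where the contractum is a substitution.
⇛-preserves : ∀ {Γ : Ctx n} {t t′ P} → Γ ⊢ t ∶ P → t ⇛ t′ → Γ ⊢ t′ ∶ P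
⇛-preserves ⊢t ⇛-var = ⊢t
⇛-preserves (abs p ⊢t ⊢s) (⇛-▶◀ d e) = abs p (⇛-preserves ⊢t d) (⇛-preserves ⊢s e)
⇛-preserves (pair⁺ ⊢t ⊢s) (⇛-pair d e) = pair⁺ (⇛-preserves ⊢t d) (⇛-preserves ⊢s e)
⇛-preserves (pair⁻ ⊢t ⊢s) (⇛-pair d e) = pair⁻ (⇛-preserves ⊢t d) (⇛-preserves ⊢s e)
⇛-preserves (π⁺ i ⊢t) (⇛-π d) = π⁺ i (⇛-preserves ⊢t d)
⇛-preserves (π⁻ i ⊢t) (⇛-π d) = π⁻ i (⇛-preserves ⊢t d)
⇛-preserves (inj⁺ i ⊢t) (⇛-inj d) = inj⁺ i (⇛-preserves ⊢t d)
⇛-preserves (inj⁻ i ⊢t) (⇛-inj d) = inj⁻ i (⇛-preserves ⊢t d)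
⇛-preserves (δ⁺ ⊢t ⊢s ⊢u) (⇛-δ d e f) =
  δ⁺ (⇛-preserves ⊢t d) (⇛-preserves ⊢s e) (⇛-preserves ⊢u f)
⇛-preserves (δ⁻ ⊢t ⊢s ⊢u) (⇛-δ d e f) =
  δ⁻ (⇛-preserves ⊢t d) (⇛-preserves ⊢s e) (⇛-preserves ⊢u f)
⇛-preserves (ν⁺ ⊢t) (⇛-ν d) = ν⁺ (⇛-preserves ⊢t d)
⇛-preserves (ν⁻ ⊢t) (⇛-ν d) = ν⁻ (⇛-preserves ⊢t d)
⇛-preserves (μ⁺ ⊢t) (⇛-μ d) = μ⁺ (⇛-preserves ⊢t d)
⇛-preserves (μ⁻ ⊢t) (⇛-μ d) = μ⁻ (⇛-preserves ⊢t d)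
⇛-preserves (IC⁺ ⊢t) (⇛-IC d) = IC⁺ (⇛-preserves ⊢t d)
⇛-preserves (IC⁻ ⊢t) (⇛-IC d) = IC⁻ (⇛-preserves ⊢t d)
⇛-preserves (app⁺ ⊢t ⊢s) (⇛-● d e) = app⁺ (⇛-preserves ⊢t d) (⇛-preserves ⊢s e)
⇛-preserves (app⁻ ⊢t ⊢s) (⇛-● d e) = app⁻ (⇛-preserves ⊢t d) (⇛-preserves ⊢s e)
⇛-preserves (π⁺ i (pair⁺ ⊢t ⊢s)) (⇛-π-pair d e) =
  choose-⊢ _⊕ i (⇛-preserves ⊢t d) (⇛-preserves ⊢s e)
⇛-preserves (π⁻ i (pair⁻ ⊢t ⊢s)) (⇛-π-pair d e) =
  choose-⊢ _⊖ i (⇛-preserves ⊢t d) (⇛-preserves ⊢s e)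
-- Splitting the index lets `choose` compute both in the contractum and in the type of the injected
-- term, which becomes the type of the variable bound by the selected branch.
⇛-preserves (δ⁺ (inj⁺ zero ⊢t) ⊢s ⊢u) (⇛-δ-inj d e f) =
  sub-⊢ (⇛-preserves ⊢s e) (⇛-preserves ⊢t d)
⇛-preserves (δ⁺ (inj⁺ (suc zero) ⊢t) ⊢s ⊢u) (⇛-δ-inj d e f) =
  sub-⊢ (⇛-preserves ⊢u f) (⇛-preserves ⊢t d)
⇛-preserves (δ⁻ (inj⁻ zero ⊢t) ⊢s ⊢u) (⇛-δ-inj d e f) =
  sub-⊢ (⇛-preserves ⊢s e) (⇛-preserves ⊢t d)
⇛-preserves (δ⁻ (inj⁻ (suc zero) ⊢t) ⊢s ⊢u) (⇛-δ-inj d e f) =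
  sub-⊢ (⇛-preserves ⊢u f) (⇛-preserves ⊢t d)
⇛-preserves (μ⁺ (ν⁺ ⊢t)) (⇛-μ-ν d) = ⇛-preserves ⊢t d
⇛-preserves (μ⁻ (ν⁻ ⊢t)) (⇛-μ-ν d) = ⇛-preserves ⊢t d
⇛-preserves (app⁺ (IC⁺ ⊢t) ⊢s) (⇛-IC-● d e) =
  sub-⊢ (⇛-preserves ⊢t d) (⇛-preserves ⊢s e)
⇛-preserves (app⁻ (IC⁻ ⊢t) ⊢s) (⇛-IC-● d e) =
  sub-⊢ (⇛-preserves ⊢t d) (⇛-preserves ⊢s e)
-- The two sides of the absurdity share one conjunction, so the selected component and `u` have
-- opposite types of the same conjunct.
⇛-preserves (abs pos (pair⁺ ⊢t ⊢s) (inj⁻ i ⊢u)) (⇛-pair-inj d e f) =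
  absurd-⊢⁺ (choose-⊢ _⊕ i (⇛-preserves ⊢t d) (⇛-preserves ⊢s e)) (⇛-preserves ⊢u f)
⇛-preserves (abs neg (pair⁻ ⊢t ⊢s) (inj⁺ i ⊢u)) (⇛-pair-inj d e f) =
  absurd-⊢⁻ (choose-⊢ _⊖ i (⇛-preserves ⊢t d) (⇛-preserves ⊢s e)) (⇛-preserves ⊢u f)
⇛-preserves (abs pos (inj⁺ i ⊢t) (pair⁻ ⊢s ⊢u)) (⇛-inj-pair d e f) =
  absurd-⊢⁺ (⇛-preserves ⊢t d) (choose-⊢ _⊖ i (⇛-preserves ⊢s e) (⇛-preserves ⊢u f))
⇛-preserves (abs neg (inj⁻ i ⊢t) (pair⁺ ⊢s ⊢u)) (⇛-inj-pair d e f) =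
  absurd-⊢⁻ (⇛-preserves ⊢t d) (choose-⊢ _⊕ i (⇛-preserves ⊢s e) (⇛-preserves ⊢u f))
⇛-preserves (abs pos (ν⁺ ⊢t) (ν⁻ ⊢s)) (⇛-ν-ν d e) =
  absurd-⊢⁻ (⇛-preserves ⊢t d) (⇛-preserves ⊢s e)
⇛-preserves (abs neg (ν⁻ ⊢t) (ν⁺ ⊢s)) (⇛-ν-ν d e) =
  absurd-⊢⁺ (⇛-preserves ⊢t d) (⇛-preserves ⊢s e)

-- Simulation of parallel steps by typed reductions

infix 4 _⊢_↝*_

-- One context serves the whole reduction here, whereas each step of `_⟶*_` may bring its own.
_⊢_↝*_ : Ctx n → Term n → Term n → Set
Γ ⊢ t ↝* s = Star (Γ ⊢_↝_) t s

module _ {Γ : Ctx n} where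

  ▶◀-↝* : ∀ {t t′ Q s s′} → Γ ⊢ t ↝* t′ → Γ ⊢ s ↝* s′ →
          Γ ⊢ t ▶◀[ Q ] s ↝* t′ ▶◀[ Q ] s′
  ▶◀-↝* ts ss = gmap _ ξ-▶◀ˡ ts ◅◅ gmap _ ξ-▶◀ʳ ss

  pair-↝* : ∀ {σ t t′ s s′} → Γ ⊢ t ↝* t′ → Γ ⊢ s ↝* s′ →
            Γ ⊢ pair σ t s ↝* pair σ t′ s′
  pair-↝* ts ss = gmap _ ξ-pairˡ ts ◅◅ gmap _ ξ-pairʳ ss

  δ-↝* : ∀ {σ t t′ P s s′ Q u u′} → Γ ⊢ t ↝* t′ → P ∷ Γ ⊢ s ↝* s′ → Q ∷ Γ ⊢ u ↝* u′ →
         Γ ⊢ δ σ t P s Q u ↝* δ σ t′ P s′ Q u′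
  δ-↝* ts ss us = gmap _ ξ-δ ts ◅◅ gmap _ ξ-δˡ ss ◅◅ gmap _ ξ-δʳ us

  ●-↝* : ∀ {σ t t′ s s′} → Γ ⊢ t ↝* t′ → Γ ⊢ s ↝* s′ → Γ ⊢ t ●[ σ ] s ↝* t′ ●[ σ ] s′
  ●-↝* ts ss = gmap _ ξ-●ˡ ts ◅◅ gmap _ ξ-●ʳ ss

-- Apart from `⇛-μ-ν`, the parts are reduced first and the redex is contracted last. The contractum
-- then already has reduced parts, which avoids substituting into `_⊢_↝*_`. The absurdity rules ask
-- for typings of the reduced operands, provided by `⇛-preserves`.
⇛⇒↝* : ∀ {Γ : Ctx n} {t t′ P} → Γ ⊢ t ∶ P → t ⇛ t′ → Γ ⊢ t ↝* t′
⇛⇒↝* ⊢t ⇛-var = ε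
⇛⇒↝* (abs _ ⊢t ⊢s) (⇛-▶◀ d e) = ▶◀-↝* (⇛⇒↝* ⊢t d) (⇛⇒↝* ⊢s e)
⇛⇒↝* (pair⁺ ⊢t ⊢s) (⇛-pair d e) = pair-↝* (⇛⇒↝* ⊢t d) (⇛⇒↝* ⊢s e)
⇛⇒↝* (pair⁻ ⊢t ⊢s) (⇛-pair d e) = pair-↝* (⇛⇒↝* ⊢t d) (⇛⇒↝* ⊢s e)
⇛⇒↝* (π⁺ _ ⊢t) (⇛-π d) = gmap _ ξ-π (⇛⇒↝* ⊢t d)
⇛⇒↝* (π⁻ _ ⊢t) (⇛-π d) = gmap _ ξ-π (⇛⇒↝* ⊢t d)
⇛⇒↝* (inj⁺ _ ⊢t) (⇛-inj d) = gmap _ ξ-inj (⇛⇒↝* ⊢t d)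
⇛⇒↝* (inj⁻ _ ⊢t) (⇛-inj d) = gmap _ ξ-inj (⇛⇒↝* ⊢t d)
⇛⇒↝* (δ⁺ ⊢t ⊢s ⊢u) (⇛-δ d e f) = δ-↝* (⇛⇒↝* ⊢t d) (⇛⇒↝* ⊢s e) (⇛⇒↝* ⊢u f)
⇛⇒↝* (δ⁻ ⊢t ⊢s ⊢u) (⇛-δ d e f) = δ-↝* (⇛⇒↝* ⊢t d) (⇛⇒↝* ⊢s e) (⇛⇒↝* ⊢u f)
⇛⇒↝* (ν⁺ ⊢t) (⇛-ν d) = gmap _ ξ-ν (⇛⇒↝* ⊢t d)
⇛⇒↝* (ν⁻ ⊢t) (⇛-ν d) = gmap _ ξ-ν (⇛⇒↝* ⊢t d)
⇛⇒↝* (μ⁺ ⊢t) (⇛-μ d) = gmap _ ξ-μ (⇛⇒↝* ⊢t d)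
⇛⇒↝* (μ⁻ ⊢t) (⇛-μ d) = gmap _ ξ-μ (⇛⇒↝* ⊢t d)
⇛⇒↝* (IC⁺ ⊢t) (⇛-IC d) = gmap _ ξ-IC (⇛⇒↝* ⊢t d)
⇛⇒↝* (IC⁻ ⊢t) (⇛-IC d) = gmap _ ξ-IC (⇛⇒↝* ⊢t d)
⇛⇒↝* (app⁺ ⊢t ⊢s) (⇛-● d e) = ●-↝* (⇛⇒↝* ⊢t d) (⇛⇒↝* ⊢s e)
⇛⇒↝* (app⁻ ⊢t ⊢s) (⇛-● d e) = ●-↝* (⇛⇒↝* ⊢t d) (⇛⇒↝* ⊢s e)
⇛⇒↝* (π⁺ _ (pair⁺ ⊢t ⊢s)) (⇛-π-pair d e) =
  gmap (π _ _) ξ-π (pair-↝* (⇛⇒↝* ⊢t d) (⇛⇒↝* ⊢s e)) ◅◅ π-pair ◅ ε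
⇛⇒↝* (π⁻ _ (pair⁻ ⊢t ⊢s)) (⇛-π-pair d e) =
  gmap (π _ _) ξ-π (pair-↝* (⇛⇒↝* ⊢t d) (⇛⇒↝* ⊢s e)) ◅◅ π-pair ◅ ε
⇛⇒↝* (δ⁺ (inj⁺ _ ⊢t) ⊢s ⊢u) (⇛-δ-inj d e f) =
  δ-↝* (gmap (inj _ _) ξ-inj (⇛⇒↝* ⊢t d)) (⇛⇒↝* ⊢s e) (⇛⇒↝* ⊢u f) ◅◅ δ-inj ◅ ε
⇛⇒↝* (δ⁻ (inj⁻ _ ⊢t) ⊢s ⊢u) (⇛-δ-inj d e f) =
  δ-↝* (gmap (inj _ _) ξ-inj (⇛⇒↝* ⊢t d)) (⇛⇒↝* ⊢s e) (⇛⇒↝* ⊢u f) ◅◅ δ-inj ◅ ε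
⇛⇒↝* (μ⁺ (ν⁺ ⊢t)) (⇛-μ-ν d) = μ-ν ◅ ⇛⇒↝* ⊢t d
⇛⇒↝* (μ⁻ (ν⁻ ⊢t)) (⇛-μ-ν d) = μ-ν ◅ ⇛⇒↝* ⊢t d
⇛⇒↝* (app⁺ (IC⁺ ⊢t) ⊢s) (⇛-IC-● d e) =
  ●-↝* (gmap _ ξ-IC (⇛⇒↝* ⊢t d)) (⇛⇒↝* ⊢s e) ◅◅ IC-● ◅ ε
⇛⇒↝* (app⁻ (IC⁻ ⊢t) ⊢s) (⇛-IC-● d e) =
  ●-↝* (gmap _ ξ-IC (⇛⇒↝* ⊢t d)) (⇛⇒↝* ⊢s e) ◅◅ IC-● ◅ ε
⇛⇒↝* (abs pos (pair⁺ ⊢t ⊢s) (inj⁻ i ⊢u)) (⇛-pair-inj d e f) =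
  ▶◀-↝* (pair-↝* (⇛⇒↝* ⊢t d) (⇛⇒↝* ⊢s e)) (gmap (inj _ _) ξ-inj (⇛⇒↝* ⊢u f)) ◅◅
  pair-inj (choose-⊢ _⊕ i (⇛-preserves ⊢t d) (⇛-preserves ⊢s e)) (⇛-preserves ⊢u f) ◅ ε
⇛⇒↝* (abs neg (pair⁻ ⊢t ⊢s) (inj⁺ i ⊢u)) (⇛-pair-inj d e f) =
  ▶◀-↝* (pair-↝* (⇛⇒↝* ⊢t d) (⇛⇒↝* ⊢s e)) (gmap (inj _ _) ξ-inj (⇛⇒↝* ⊢u f)) ◅◅
  pair-inj (choose-⊢ _⊖ i (⇛-preserves ⊢t d) (⇛-preserves ⊢s e)) (⇛-preserves ⊢u f) ◅ ε
⇛⇒↝* (abs pos (inj⁺ i ⊢t) (pair⁻ ⊢s ⊢u)) (⇛-inj-pair d e f) =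
  ▶◀-↝* (gmap (inj _ _) ξ-inj (⇛⇒↝* ⊢t d)) (pair-↝* (⇛⇒↝* ⊢s e) (⇛⇒↝* ⊢u f)) ◅◅
  inj-pair (⇛-preserves ⊢t d) (choose-⊢ _⊖ i (⇛-preserves ⊢s e) (⇛-preserves ⊢u f)) ◅ ε
⇛⇒↝* (abs neg (inj⁻ i ⊢t) (pair⁺ ⊢s ⊢u)) (⇛-inj-pair d e f) =
  ▶◀-↝* (gmap (inj _ _) ξ-inj (⇛⇒↝* ⊢t d)) (pair-↝* (⇛⇒↝* ⊢s e) (⇛⇒↝* ⊢u f)) ◅◅
  inj-pair (⇛-preserves ⊢t d) (choose-⊢ _⊕ i (⇛-preserves ⊢s e) (⇛-preserves ⊢u f)) ◅ ε
⇛⇒↝* (abs pos (ν⁺ ⊢t) (ν⁻ ⊢s)) (⇛-ν-ν d e) =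
  ▶◀-↝* (gmap _ ξ-ν (⇛⇒↝* ⊢t d)) (gmap _ ξ-ν (⇛⇒↝* ⊢s e)) ◅◅
  ν-ν (⇛-preserves ⊢t d) (⇛-preserves ⊢s e) ◅ ε
⇛⇒↝* (abs neg (ν⁻ ⊢t) (ν⁺ ⊢s)) (⇛-ν-ν d e) =
  ▶◀-↝* (gmap _ ξ-ν (⇛⇒↝* ⊢t d)) (gmap _ ξ-ν (⇛⇒↝* ⊢s e)) ◅◅
  ν-ν (⇛-preserves ⊢t d) (⇛-preserves ⊢s e) ◅ ε

-- Confluence on typable terms

⟶⇒⇛ : {t s : Term n} → t ⟶ s → t ⇛ s
⟶⇒⇛ (_ , _ , ⊢t , r) = ↝⇒⇛ ⊢t r

-- Each step of `_⟶_` must carry a typing of its source. The next source is typed by viewing the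
-- step just made as a parallel one and applying `⇛-preserves`.
↝*⇒⟶* : ∀ {Γ : Ctx n} {t s P} → Γ ⊢ t ∶ P → Γ ⊢ t ↝* s → t ⟶* s
↝*⇒⟶* ⊢t ε        = ε
↝*⇒⟶* ⊢t (r ◅ rs) =
  (_ , _ , ⊢t , r) ◅ ↝*⇒⟶* (⇛-preserves ⊢t (↝⇒⇛ ⊢t r)) rs

⇛*⇒⟶* : ∀ {Γ : Ctx n} {t s P} → Γ ⊢ t ∶ P → t ⇛* s → t ⟶* s
⇛*⇒⟶* ⊢t ε        = ε
⇛*⇒⟶* ⊢t (d ◅ ds) =
  ↝*⇒⟶* ⊢t (⇛⇒↝* ⊢t d) ◅◅ ⇛*⇒⟶* (⇛-preserves ⊢t d) ds

proposition25 : ∀ {n} (t₀ t₁ t₂ : Term n) →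
    Typable t₀ → Typable t₁ → Typable t₂ →
    t₀ ⟶* t₁ → t₀ ⟶* t₂ →
    ∃[ t₃ ] ((t₁ ⟶* t₃) × (t₂ ⟶* t₃))
proposition25 t₀ t₁ t₂ _ (_ , _ , ⊢t₁) (_ , _ , ⊢t₂) rs ss
  -- The mapping is stepwise, each step using its own typing, so the contexts along `rs` and `ss`
  -- need not agree.
  with t₃ , ds , es ← ⇛-confluent (Star.map ⟶⇒⇛ rs) (Star.map ⟶⇒⇛ ss)
  = t₃ , ⇛*⇒⟶* ⊢t₁ ds , ⇛*⇒⟶* ⊢t₂ es
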